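{- Let $s,t$ be positive integers. Then $prc(K_{s,t})=\max\{s,t\}$.
   Context: $K_{s,t}$ is the complete bipartite graph with parts of sizes $s$ and $t$. A path in an edge-coloured graph is a rainbow path if its edges receive pairwise distinct colours. The proper rainbow connection number $prc(G)$ is the minimum number of colours in a proper edge-colouring (adjacent edges get distinct colours) such that every two distinct vertices are joined by a rainbow path. -}

module Defs where

open import Data.Fin using (Fin)
open import Data.List using (List; []; _∷_)
open import Data.List.Relation.Unary.Unique.Propositional using (Unique)
open import Data.Nat using (ℕ; _≤_)
open import Data.Product using (_×_; Σ)
open import Data.Sum using (_⊎_; inj₁; inj₂)
open import Relation.Binary.Definitions using (Symmetric; Irreflexive)
open import Relation.Binary.PropositionalEquality using (_≡_; _≢_; refl)

record SimpleGraph : Set₁ where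
  field
    Vertex   : Set
    Adj      : Vertex → Vertex → Set
    adj-sym  : Symmetric Adj
    adj-irr  : Irreflexive _≡_ Adj

module _ (G : SimpleGraph) where
  open SimpleGraph G

  -- An edge is an unordered pair of adjacent vertices, so a colouring is
  -- symmetric in the endpoints and (by the irrelevant argument) independent
  -- of the proof of adjacency.
  record EdgeColouring (k : ℕ) : Set where
    field
      colour     : (u v : Vertex) → .(Adj u v) → Fin k
      colour-sym : ∀ {u v} (e : Adj u v) → colour u v e ≡ colour v u (adj-sym e)

  data Walk : Vertex → Vertex → Set where
    nil  : ∀ {u} → Walk u u
    cons : ∀ {u v w} → Adj u v → Walk v w → Walk u w

  vertices : ∀ {u v} → Walk u v → List Vertex
  vertices {u} nil        = u ∷ []
  vertices {u} (cons _ p) = u ∷ vertices p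

  IsPath : ∀ {u v} → Walk u v → Set
  IsPath p = Unique (vertices p)

  module _ {k : ℕ} (c : EdgeColouring k) where
    open EdgeColouring c

    -- Since colour is symmetric, it suffices to compare the two edges as
    -- oriented away from their common endpoint u.
    Proper : Set
    Proper = ∀ {u v w} (e : Adj u v) (f : Adj u w) → v ≢ w →
             colour u v e ≢ colour u w f

    colours : ∀ {u v} → Walk u v → List (Fin k)
    colours nil                      = []
    colours (cons {u = u} {v = v} e p) = colour u v e ∷ colours p

    IsRainbowPath : ∀ {u v} → Walk u v → Set
    IsRainbowPath p = IsPath p × Unique (colours p)

    RainbowConnected : Set
    RainbowConnected = ∀ (u v : Vertex) → u ≢ v → Σ (Walk u v) IsRainbowPath

  ProperRainbowColourable : ℕ → Set
  ProperRainbowColourable k =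
    Σ (EdgeColouring k) λ c → Proper c × RainbowConnected c

-- prc G is only partially defined (a disconnected graph has no such colouring),
-- so "prc(G) = n" is a relation: n is the least element of the set of
-- admissible palette sizes.
prc[_]≡_ : SimpleGraph → ℕ → Set
prc[ G ]≡ n =
  ProperRainbowColourable G n × (∀ k → ProperRainbowColourable G k → n ≤ k)

data KAdj (s t : ℕ) : Fin s ⊎ Fin t → Fin s ⊎ Fin t → Set where
  left-right : ∀ i j → KAdj s t (inj₁ i) (inj₂ j)
  right-left : ∀ i j → KAdj s t (inj₂ j) (inj₁ i)

K : ℕ → ℕ → SimpleGraph
K s t = record
  { Vertex  = Fin s ⊎ Fin t
  ; Adj     = KAdj s t
  ; adj-sym = λ { (left-right i j) → right-left i j ; (right-left i j) → left-right i j }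
  ; adj-irr = λ { refl () }
  }

{-# OPTIONS --safe #-}
-- An edge of K_{s,t} is a rainbow path, and two vertices in the same part have a common
-- neighbour, where a proper colouring gives the two edges distinct colours. Hence every proper
-- colouring is rainbow connected and prc equals the chromatic index: the edges at one vertex
-- need max{s,t} colours, and colouring the edge ij by i + j mod max{s,t} is proper.

module Submission where

open import Defs
open import Data.Nat using (ℕ; suc; NonZero; _⊔_; _+_; _∸_; _%_; _≤_; _<_)
open import Data.Nat.DivMod using (_mod_; %-distribˡ-+; m%n%n≡m%n; [m+n]%n≡m%n; m<n⇒m%n≡m; m%n<n)
open import Data.Nat.Properties using (+-comm; +-assoc; m+[n∸m]≡n; <⇒≤; <-≤-trans; m≤m⊔n; m≤n⊔m; ⊔-lub)
open import Data.Fin using (Fin; zero; toℕ; _≟_)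
open import Data.Fin.Properties using (toℕ<n; toℕ-fromℕ<; toℕ-injective; injective⇒≤)
open import Data.List.Relation.Unary.All using ([]; _∷_)
open import Data.List.Relation.Unary.AllPairs using ([]; _∷_)
open import Data.Product using (_,_)
open import Data.Sum using (inj₁; inj₂)
open import Data.Sum.Properties using (inj₁-injective; inj₂-injective)
open import Function using (_∘_)
open import Relation.Nullary.Decidable using (decidable-stable)
open import Relation.Binary.PropositionalEquality

-- Modulo `d`, `d ∸ m` is the additive inverse of `m`, so adding it undoes the shift by `m`. The
-- bound `m ≤ d` makes the truncated subtraction exact, and `n < d` makes `n` its own residue.
[[m+n]%d+[d∸m]]%d≡n : ∀ {m n d} .{{_ : NonZero d}} → m ≤ d → n < d →
                      ((m + n) % d + (d ∸ m)) % d ≡ n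
[[m+n]%d+[d∸m]]%d≡n {m} {n} {d} m≤d n<d = begin
  ((m + n) % d + (d ∸ m)) % d                ≡⟨ %-distribˡ-+ ((m + n) % d) (d ∸ m) d ⟩
  ((m + n) % d % d + (d ∸ m) % d) % d        ≡⟨ cong (λ x → (x + (d ∸ m) % d) % d) (m%n%n≡m%n (m + n) d) ⟩
  ((m + n) % d + (d ∸ m) % d) % d            ≡⟨ %-distribˡ-+ (m + n) (d ∸ m) d ⟨
  (m + n + (d ∸ m)) % d                      ≡⟨ cong (λ x → (x + (d ∸ m)) % d) (+-comm m n) ⟩
  (n + m + (d ∸ m)) % d                      ≡⟨ cong (_% d) (+-assoc n m (d ∸ m)) ⟩
  (n + (m + (d ∸ m))) % d                    ≡⟨ cong (λ x → (n + x) % d) (m+[n∸m]≡n m≤d) ⟩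
  (n + d) % d                                ≡⟨ [m+n]%n≡m%n n d ⟩
  n % d                                      ≡⟨ m<n⇒m%n≡m n<d ⟩
  n                                          ∎
  where open ≡-Reasoning

toℕ-mod : ∀ m d .{{_ : NonZero d}} → toℕ (m mod d) ≡ m % d
toℕ-mod m d = toℕ-fromℕ< (m%n<n m d)

+-mod-cancelˡ : ∀ {m n o d} .{{_ : NonZero d}} → m ≤ d → n < d → o < d →
                (m + n) mod d ≡ (m + o) mod d → n ≡ o
+-mod-cancelˡ {m} {n} {o} {d} m≤d n<d o<d eq = begin
  n                            ≡⟨ [[m+n]%d+[d∸m]]%d≡n m≤d n<d ⟨
  ((m + n) % d + (d ∸ m)) % d  ≡⟨ cong (λ x → (x + (d ∸ m)) % d) %-eq ⟩
  ((m + o) % d + (d ∸ m)) % d  ≡⟨ [[m+n]%d+[d∸m]]%d≡n m≤d o<d ⟩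
  o                            ∎
  where
  open ≡-Reasoning
  %-eq : (m + n) % d ≡ (m + o) % d
  %-eq = trans (sym (toℕ-mod (m + n) d)) (trans (cong toℕ eq) (toℕ-mod (m + o) d))

-- This is properness at one vertex `i`: an edge's colour determines its other endpoint. The sizes
-- `a` and `b` are separate so that either part can contain `i`.
+-mod-injective : ∀ {a b d} .{{_ : NonZero d}} → a ≤ d → b ≤ d → (i : Fin a) {j j′ : Fin b} →
                  (toℕ i + toℕ j) mod d ≡ (toℕ i + toℕ j′) mod d → j ≡ j′
+-mod-injective a≤d b≤d i {j} {j′} eq = toℕ-injective
  (+-mod-cancelˡ (<⇒≤ (<-≤-trans (toℕ<n i) a≤d)) (<-≤-trans (toℕ<n j) b≤d) (<-≤-trans (toℕ<n j′) b≤d) eq)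

module _ {s t d : ℕ} .{{_ : NonZero d}} where

  cyclicColouring : EdgeColouring (K s t) d
  cyclicColouring = record { colour = colour ; colour-sym = colour-sym }
    where
    open SimpleGraph (K s t)

    colour : (u v : Vertex) → .(Adj u v) → Fin d
    colour (inj₁ i) (inj₂ j) _ = (toℕ i + toℕ j) mod d
    -- The first endpoint's index is the left summand in both orientations. As `Proper` orients
    -- edges away from the common endpoint, cancellation on the left then serves both parts.
    colour (inj₂ j) (inj₁ i) _ = (toℕ j + toℕ i) mod d
    colour (inj₁ _) (inj₁ _) ()
    colour (inj₂ _) (inj₂ _) ()

    colour-sym : ∀ {u v} (e : Adj u v) → colour u v e ≡ colour v u (adj-sym e)
    colour-sym (left-right i j) = cong (_mod d) (+-comm (toℕ i) (toℕ j))
    colour-sym (right-left i j) = cong (_mod d) (+-comm (toℕ j) (toℕ i))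

  cyclicColouring-proper : s ≤ d → t ≤ d → Proper (K s t) cyclicColouring
  cyclicColouring-proper s≤d t≤d (left-right i _) (left-right _ _) v≢w =
    v≢w ∘ cong inj₂ ∘ +-mod-injective s≤d t≤d i
  cyclicColouring-proper s≤d t≤d (right-left _ j) (right-left _ _) v≢w =
    v≢w ∘ cong inj₁ ∘ +-mod-injective t≤d s≤d j

module _ {s t k : ℕ} (c : EdgeColouring (K (suc s) (suc t)) k)
         (proper : Proper (K (suc s) (suc t)) c) where
  open EdgeColouring c

  proper⇒rainbowConnected : RainbowConnected (K (suc s) (suc t)) c
  proper⇒rainbowConnected (inj₁ i) (inj₂ j) u≢v = cons (left-right i j) nil , ((u≢v ∷ []) ∷ [] ∷ []) , ([] ∷ [])
  proper⇒rainbowConnected (inj₂ j) (inj₁ i) u≢v = cons (right-left i j) nil , ((u≢v ∷ []) ∷ [] ∷ []) , ([] ∷ [])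
  proper⇒rainbowConnected (inj₁ i) (inj₁ i′) u≢v =
      cons (left-right i zero) (cons (right-left i′ zero) nil)
    , (((λ ()) ∷ u≢v ∷ []) ∷ ((λ ()) ∷ []) ∷ [] ∷ [])
    -- The walk enters the common neighbour `zero` along its first edge, whereas `proper` wants both
    -- edges leaving it; `colour-sym` reverses that edge.
    , ((λ eq → proper (right-left i zero) (right-left i′ zero) u≢v
                 (trans (sym (colour-sym (left-right i zero))) eq)) ∷ []) ∷ [] ∷ []
  proper⇒rainbowConnected (inj₂ j) (inj₂ j′) u≢v =
      cons (right-left zero j) (cons (left-right zero j′) nil)
    , (((λ ()) ∷ u≢v ∷ []) ∷ ((λ ()) ∷ []) ∷ [] ∷ [])
    , ((λ eq → proper (left-right zero j) (left-right zero j′) u≢v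
                 (trans (sym (colour-sym (right-left zero j))) eq)) ∷ []) ∷ [] ∷ []

  -- The edges at vertex `zero` of either part are indexed by the opposite part, so their colours
  -- inject that part into the palette.
  proper⇒⊔≤ : suc s ⊔ suc t ≤ k
  proper⇒⊔≤ = ⊔-lub
    (injective⇒≤ {f = λ i → colour (inj₂ zero) (inj₁ i) (right-left i zero)} λ {i} {i′} eq →
      -- Properness only refutes `i ≢ i′`; decidable equality turns this into `i ≡ i′`.
      decidable-stable (i ≟ i′) λ i≢i′ →
        proper (right-left i zero) (right-left i′ zero) (i≢i′ ∘ inj₁-injective) eq)
    (injective⇒≤ {f = λ j → colour (inj₁ zero) (inj₂ j) (left-right zero j)} λ {j} {j′} eq →
      decidable-stable (j ≟ j′) λ j≢j′ →
        proper (left-right zero j) (left-right zero j′) (j≢j′ ∘ inj₂-injective) eq)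

theorem5p3 : (s t : ℕ) → .{{_ : NonZero s}} → .{{_ : NonZero t}} → prc[ K s t ]≡ (s ⊔ t)
-- With both sizes successors, `s ⊔ t` reduces to a successor, a valid modulus, and each part has a
-- vertex `zero`.
theorem5p3 s@(suc _) t@(suc _) =
    (cyclicColouring , proper , proper⇒rainbowConnected cyclicColouring proper)
  , λ k (c , c-proper , _) → proper⇒⊔≤ c c-proper
  where
  proper : Proper (K s t) (cyclicColouring {d = s ⊔ t})
  proper = cyclicColouring-proper (m≤m⊔n s t) (m≤n⊔m s t)
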